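{- Let $B>3$ be an odd integer, and let $K_B\colon X_B\to X_B$ be the four-digit Kaprekar map in difference coordinates. Then: (1) $K_B(\mathcal{T}_B)\subseteq \mathcal{T}_B$ and $K_B^3(X_B)\subseteq \mathcal{T}_B$, where $K_B^3=K_B\circ K_B\circ K_B$. (2) The restricted map $K_B\colon \mathcal{T}_B\to\mathcal{T}_B$ is conjugate to the doubling map $$\delta\colon \binom{P_B}{2}\to\binom{P_B}{2},\qquad \{[r],[s]\}\longmapsto\{[2r],[2s]\},$$ under the transformation $$\Phi\colon \mathcal{T}_B\to\binom{P_B}{2},\qquad (d_1,d_2)\longmapsto \left\{\left[\frac{d_1+d_2}{2}\right],\left[\frac{d_1-d_2}{2}\right]\right\}.$$ That is, $\Phi$ is a well-defined bijection and $\Phi(K_B(d_1,d_2))=\delta(\Phi(d_1,d_2))$ for all $(d_1,d_2)\in\mathcal{T}_B$.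
   Context: State space: $X_B=\{(d_1,d_2)\in\mathbb{Z}^2 : 1\le d_1<B,\ 0\le d_2\le d_1\}$. Stable region: $\mathcal{T}_B=\{(d_1,d_2)\in X_B : d_1>d_2>0,\ d_1\text{ and }d_2\text{ both odd}\}$. Kaprekar routine: a four-digit string in base $B$ is a sequence of four digits in $\{0,\dots,B-1\}$ (leading zeros allowed). Given such a string, not all digits equal, with digits sorted as $a_1\ge a_2\ge a_3\ge a_4$, its difference pair is $(d_1,d_2)=(a_1-a_4,\ a_2-a_3)\in X_B$. One Kaprekar step replaces it by the four-digit base-$B$ string (with leading zeros if needed) of the number $$(a_1B^3+a_2B^2+a_3B+a_4)-(a_4B^3+a_3B^2+a_2B+a_1)=d_1(B^3-1)+d_2(B^2-B),$$ which depends only on $(d_1,d_2)$. The map $K_B\colon X_B\to X_B$ sends $(d_1,d_2)$ to the difference pair of the resulting string. Explicitly, the (unsorted) digits of the resulting string are $[d_1,\ d_2-1,\ B-d_2-1,\ B-d_1]$ if $d_2>0$, and $[d_1-1,\ B-1,\ B-1,\ B-d_1]$ if $d_2=0$; $K_B(d_1,d_2)$ is obtained by sorting these four digits as $a_1'\ge a_2'\ge a_3'\ge a_4'$ and taking $(a_1'-a_4',\ a_2'-a_3')$. Projective classes: $P_B=\bigl((\mathbb{Z}/B\mathbb{Z})\setminus\{0\}\bigr)/\{\pm1\}$; for nonzero $x\in\mathbb{Z}/B\mathbb{Z}$, $[x]=\{x,-x\}\in P_B$ (integers not divisible by $B$ are reduced modulo $B$). $\binom{P_B}{2}$ is the set of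 unordered two-element subsets of $P_B$. -}

module Defs where

open import Data.Fin.Base as Fin using (Fin; toℕ)
import Data.Fin.Properties as Fin
open import Data.Integer.Base as ℤ using (ℤ; +_; 0ℤ)
open import Data.Integer.Divisibility.Signed as ℤ using (divides)
import Data.Integer.Properties as ℤ
import Data.Integer.Tactic.RingSolver as ℤ
open import Data.List.Base using (length)
open import Data.List.Relation.Binary.Permutation.Propositional using (_↭_; ↭-reflexive; ↭-trans)
open import Data.List.Relation.Binary.Permutation.Propositional.Properties using (↭-length; All-resp-↭)
open import Data.List.Relation.Unary.All using (All; []; _∷_)
open import Data.List.Relation.Unary.Linked using ([-]; _∷_)
open import Data.List.Sort.InsertionSort using (insertionSort)
open import Data.List.Sort.Base using (SortingAlgorithm)
open import Data.Nat.Base hiding (_⊔_)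
open import Data.Nat.Divisibility as ℕ∣ using (_∣_)
open import Data.Nat.DivMod
open import Data.Nat.Properties
open import Data.Nat.Tactic.RingSolver using (solve-∀)
open import Data.Product using (Σ; Σ-syntax; ∃; _×_; _,_; proj₁)
open import Data.Sum as Sum using (_⊎_; inj₁; inj₂)
open import Data.Vec.Base as Vec using (Vec; []; _∷_; toList; fromList)
open import Data.Vec.Properties using (toList-cast; length-toList; toList∘fromList)
open import Function using (_∘_; Func)
open import Level using (_⊔_; 0ℓ)
open import Relation.Binary using (Setoid; DecTotalOrder)
import Relation.Binary.Construct.Flip.EqAndOrd as Flip
import Relation.Binary.Construct.On as On
open import Relation.Binary.PropositionalEquality
open import Relation.Nullary using (¬_)

Odd : ℕ → Set
Odd n = n % 2 ≡ 1

record X (B : ℕ) : Set where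
  constructor mkX
  field
    d₁ d₂ : ℕ
    1≤d₁  : 1 ≤ d₁
    d₁<B  : d₁ < B
    d₂≤d₁ : d₂ ≤ d₁

  coordinates : ℕ × ℕ
  coordinates = d₁ , d₂

open X public using (d₁; d₂; coordinates)

record Stable {B : ℕ} (x : X B) : Set where
  constructor mkStable
  field
    d₂<d₁  : d₂ x < d₁ x
    0<d₂   : 0 < d₂ x
    d₁-odd : Odd (d₁ x)
    d₂-odd : Odd (d₂ x)

-- Elements are compared by their coordinates, so that the membership
-- proofs carried along play no role.
𝒯 : ℕ → Setoid 0ℓ 0ℓ
𝒯 B = On.setoid {B = Σ (X B) Stable} (setoid (ℕ × ℕ)) (coordinates ∘ proj₁)

-- Most significant digit first.
DigitString : ℕ → Set
DigitString B = Vec (Fin B) 4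

AllEqual : ∀ {B} → DigitString B → Set
AllEqual s = ∃ λ c → All (_≡ c) (toList s)

-- The last four base-B digits of n; all of them when n < B ^ 4.
digits : (B : ℕ) .{{_ : NonZero B}} → ℕ → DigitString B
digits B n = (n / B / B / B) mod B ∷ (n / B / B) mod B ∷ (n / B) mod B ∷ n mod B ∷ []

module _ {B : ℕ} where
  private
    ≥-decTotalOrder = Flip.decTotalOrder (Fin.≤-decTotalOrder B)

  open SortingAlgorithm (insertionSort ≥-decTotalOrder)
  open import Data.List.Relation.Unary.Sorted.TotalOrder
    (DecTotalOrder.totalOrder ≥-decTotalOrder) using () renaming (Sorted to Descending)

  length-sort : (s : DigitString B) → length (sort (toList s)) ≡ 4
  length-sort s = trans (↭-length (sort-↭ (toList s))) (length-toList s)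

  sortDescending : DigitString B → DigitString B
  sortDescending s = Vec.cast (length-sort s) (fromList (sort (toList s)))

  toList-sortDescending : ∀ s → toList (sortDescending s) ≡ sort (toList s)
  toList-sortDescending s = trans (toList-cast (length-sort s) _) (toList∘fromList _)

  sortDescending-↭ : ∀ s → toList (sortDescending s) ↭ toList s
  sortDescending-↭ s = ↭-trans (↭-reflexive (toList-sortDescending s)) (sort-↭ (toList s))

  sortDescending-↘ : ∀ s → Descending (toList (sortDescending s))
  sortDescending-↘ s = subst Descending (sym (toList-sortDescending s)) (sort-↗ (toList s))

  outerDifference innerDifference : DigitString B → ℕ
  outerDifference (a₁ ∷ a₂ ∷ a₃ ∷ a₄ ∷ []) = toℕ a₁ ∸ toℕ a₄
  innerDifference (a₁ ∷ a₂ ∷ a₃ ∷ a₄ ∷ []) = toℕ a₂ ∸ toℕ a₃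

  outerDifference<B : ∀ a → outerDifference a < B
  outerDifference<B (a₁ ∷ _ ∷ _ ∷ a₄ ∷ []) = ≤-<-trans (m∸n≤m (toℕ a₁) (toℕ a₄)) (Fin.toℕ<n a₁)

  innerDifference≤outerDifference : ∀ a → Descending (toList a) → innerDifference a ≤ outerDifference a
  innerDifference≤outerDifference (_ ∷ _ ∷ _ ∷ _ ∷ []) (a₂≤a₁ ∷ _ ∷ a₄≤a₃ ∷ [-]) = ∸-mono a₂≤a₁ a₄≤a₃

  0<outerDifference : ∀ a → Descending (toList a) → ¬ AllEqual a → 0 < outerDifference a
  0<outerDifference (a₁ ∷ a₂ ∷ a₃ ∷ a₄ ∷ []) (a₂≤a₁ ∷ a₃≤a₂ ∷ a₄≤a₃ ∷ [-]) a-mixed =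
    m<n⇒0<n∸m (≰⇒> λ a₁≤a₄ → a-mixed (a₄ ,
        Fin.≤-antisym a₁≤a₄ (≤-trans a₄≤a₃ (≤-trans a₃≤a₂ a₂≤a₁))
      ∷ Fin.≤-antisym (≤-trans a₂≤a₁ a₁≤a₄) (≤-trans a₄≤a₃ a₃≤a₂)
      ∷ Fin.≤-antisym (≤-trans a₃≤a₂ (≤-trans a₂≤a₁ a₁≤a₄)) a₄≤a₃
      ∷ refl ∷ []))

  differencePair : (s : DigitString B) → ¬ AllEqual s → X B
  differencePair s s-mixed = record
    { d₁    = outerDifference (sortDescending s)
    ; d₂    = innerDifference (sortDescending s)
    ; 1≤d₁  = 0<outerDifference (sortDescending s) (sortDescending-↘ s)
                λ (c , all≡c) → s-mixed (c , All-resp-↭ (sortDescending-↭ s) all≡c)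
    ; d₁<B  = outerDifference<B (sortDescending s)
    ; d₂≤d₁ = innerDifference≤outerDifference (sortDescending s) (sortDescending-↘ s)
    }

-- For digits a₁ ≥ a₂ ≥ a₃ ≥ a₄ with difference pair (d₁ , d₂), this is
-- (a₁ B³ + a₂ B² + a₃ B + a₄) - (a₄ B³ + a₃ B² + a₂ B + a₁).
-- Both uses of ∸ are exact since 1 ≤ B.
stepNumber : ∀ {B} → X B → ℕ
stepNumber {B} x = d₁ x * (B ^ 3 ∸ 1) + d₂ x * (B ^ 2 ∸ B)

base-nonZero : ∀ {B} → X B → NonZero B
base-nonZero x = >-nonZero (≤-<-trans z≤n (X.d₁<B x))

stepString : ∀ {B} → X B → DigitString B
stepString {B} x = digits B {{base-nonZero x}} (stepNumber x)

module _ {B : ℕ} .{{_ : NonZero B}} where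
  open ≡-Reasoning

  horner-% : ∀ q {e} → e < B → (q * B + e) % B ≡ e
  horner-% q {e} e<B = begin
    (q * B + e) % B ≡⟨ cong (_% B) (+-comm (q * B) e) ⟩
    (e + q * B) % B ≡⟨ [m+kn]%n≡m%n e q B ⟩
    e % B           ≡⟨ m<n⇒m%n≡m e<B ⟩
    e               ∎

  horner-/ : ∀ q {e} → e < B → (q * B + e) / B ≡ q
  horner-/ q {e} e<B = begin
    (q * B + e) / B     ≡⟨ +-distrib-/-∣ˡ e (ℕ∣.divides q refl) ⟩
    q * B / B + e / B   ≡⟨ cong₂ _+_ (m*n/n≡m q B) (m<n⇒m/n≡0 e<B) ⟩
    q + 0               ≡⟨ +-identityʳ q ⟩
    q                   ∎

  toℕ-mod : ∀ n → toℕ (n mod B) ≡ n % B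
  toℕ-mod n = Fin.toℕ-fromℕ< (m%n<n n B)

  digits-horner : ∀ {a b c e} → a < B → b < B → c < B → e < B →
    Vec.map toℕ (digits B (((a * B + b) * B + c) * B + e)) ≡ a ∷ b ∷ c ∷ e ∷ []
  digits-horner {a} {b} {c} {e} a<B b<B c<B e<B = cong₂ _∷_ eq₁ (cong₂ _∷_ eq₂ (cong₂ _∷_ eq₃ (cong (_∷ []) eq₄)))
    where
    n = ((a * B + b) * B + c) * B + e
    n/B : n / B ≡ (a * B + b) * B + c
    n/B = horner-/ ((a * B + b) * B + c) e<B
    n/B² : n / B / B ≡ a * B + b
    n/B² = trans (/-congˡ n/B) (horner-/ (a * B + b) c<B)
    n/B³ : n / B / B / B ≡ a
    n/B³ = trans (/-congˡ n/B²) (horner-/ a b<B)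
    eq₁ = trans (toℕ-mod (n / B / B / B)) (trans (%-congˡ n/B³) (m<n⇒m%n≡m a<B))
    eq₂ = trans (toℕ-mod (n / B / B)) (trans (%-congˡ n/B²) (horner-% a b<B))
    eq₃ = trans (toℕ-mod (n / B)) (trans (%-congˡ n/B) (horner-% (a * B + b) c<B))
    eq₄ = trans (toℕ-mod n) (horner-% ((a * B + b) * B + c) e<B)

^3∸1 : ∀ a B → 1 ≤ B → a * (B ^ 3 ∸ 1) + a ≡ a * B ^ 3
^3∸1 a B 1≤B = begin
  a * (B ^ 3 ∸ 1) + a     ≡⟨ cong (λ z → a * (B ^ 3 ∸ 1) + z) (*-identityʳ a) ⟨
  a * (B ^ 3 ∸ 1) + a * 1 ≡⟨ *-distribˡ-+ a (B ^ 3 ∸ 1) 1 ⟨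
  a * (B ^ 3 ∸ 1 + 1)     ≡⟨ cong (a *_) (m∸n+n≡m (^-monoˡ-≤ 3 1≤B)) ⟩
  a * B ^ 3               ∎
  where open ≡-Reasoning

^2∸B : ∀ k B → 1 ≤ B → k * (B ^ 2 ∸ B) + k * B ≡ k * B ^ 2
^2∸B k B 1≤B = begin
  k * (B ^ 2 ∸ B) + k * B ≡⟨ *-distribˡ-+ k (B ^ 2 ∸ B) B ⟨
  k * (B ^ 2 ∸ B + B)     ≡⟨ cong (k *_) (m∸n+n≡m (m≤m*n B (B * 1) {{>-nonZero (subst (1 ≤_) (sym (*-identityʳ B)) 1≤B)}})) ⟩
  k * B ^ 2               ∎
  where open ≡-Reasoning

stepNumber-pos : ∀ a k v u B → u + a ≡ B → v + suc (suc k) ≡ B → 1 ≤ B →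
  a * (B ^ 3 ∸ 1) + suc k * (B ^ 2 ∸ B) ≡ ((a * B + k) * B + v) * B + u
stepNumber-pos a k v u B u+a≡B v+k≡B 1≤B = +-cancelʳ-≡ (a + suc k * B) _ _ (begin
  a * (B ^ 3 ∸ 1) + suc k * (B ^ 2 ∸ B) + (a + suc k * B)   ≡⟨ interchange (a * (B ^ 3 ∸ 1)) (suc k * (B ^ 2 ∸ B)) a (suc k * B) ⟩
  a * (B ^ 3 ∸ 1) + a + (suc k * (B ^ 2 ∸ B) + suc k * B)   ≡⟨ cong₂ _+_ (^3∸1 a B 1≤B) (^2∸B (suc k) B 1≤B) ⟩
  a * B ^ 3 + suc k * B ^ 2                                 ≡⟨ expand a k B ⟩
  (a * B + k) * B * B + B * B                               ≡⟨ cong (λ z → (a * B + k) * B * B + z * B) v+k≡B ⟨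
  (a * B + k) * B * B + (v + suc (suc k)) * B               ≡⟨ peel a k v B ⟩
  (a * B + k) * B * B + (v + suc k) * B + B                 ≡⟨ cong (λ z → (a * B + k) * B * B + (v + suc k) * B + z) u+a≡B ⟨
  (a * B + k) * B * B + (v + suc k) * B + (u + a)           ≡⟨ regroup a k v u B ⟩
  ((a * B + k) * B + v) * B + u + (a + suc k * B)           ∎)
  where
  open ≡-Reasoning
  interchange : ∀ p q r s → p + q + (r + s) ≡ p + r + (q + s)
  interchange = solve-∀
  expand : ∀ a k B → a * (B * (B * (B * 1))) + suc k * (B * (B * 1)) ≡ (a * B + k) * B * B + B * B
  expand = solve-∀
  peel : ∀ a k v B → (a * B + k) * B * B + (v + suc (suc k)) * B ≡ (a * B + k) * B * B + (v + suc k) * B + B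
  peel = solve-∀
  regroup : ∀ a k v u B → (a * B + k) * B * B + (v + suc k) * B + (u + a) ≡ ((a * B + k) * B + v) * B + u + (a + suc k * B)
  regroup = solve-∀

stepNumber-zero : ∀ k w u → u + suc k ≡ suc w →
  suc k * (suc w ^ 3 ∸ 1) + 0 ≡ ((k * suc w + w) * suc w + w) * suc w + u
stepNumber-zero k w u u+k≡B = +-cancelʳ-≡ (suc k) _ _ (begin
  suc k * (suc w ^ 3 ∸ 1) + 0 + suc k                 ≡⟨ cong (_+ suc k) (+-identityʳ _) ⟩
  suc k * (suc w ^ 3 ∸ 1) + suc k                     ≡⟨ ^3∸1 (suc k) (suc w) (s≤s z≤n) ⟩
  suc k * suc w ^ 3                                   ≡⟨ expand k w ⟩
  ((k * suc w + w) * suc w + w) * suc w + suc w       ≡⟨ cong (λ z → ((k * suc w + w) * suc w + w) * suc w + z) u+k≡B ⟨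
  ((k * suc w + w) * suc w + w) * suc w + (u + suc k) ≡⟨ +-assoc (((k * suc w + w) * suc w + w) * suc w) u (suc k) ⟨
  ((k * suc w + w) * suc w + w) * suc w + u + suc k   ∎)
  where
  open ≡-Reasoning
  expand : ∀ k w → suc k * (suc w * (suc w * (suc w * 1))) ≡ ((k * suc w + w) * suc w + w) * suc w + suc w
  expand = solve-∀

stepDigits : ∀ {B} → X B → Vec ℕ 4
stepDigits {B} (mkX d₁ zero     _ _ _) = d₁ ∸ 1 ∷ B ∸ 1 ∷ B ∸ 1 ∷ B ∸ d₁ ∷ []
stepDigits {B} (mkX d₁ (suc d₂) _ _ _) = d₁ ∷ d₂ ∷ B ∸ suc d₂ ∸ 1 ∷ B ∸ d₁ ∷ []

stepString-digits : ∀ {B} (x : X B) → Vec.map toℕ (stepString x) ≡ stepDigits x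
stepString-digits {suc w} x@(mkX (suc k) zero _ k<w _) = trans
  (cong (Vec.map toℕ ∘ digits (suc w)) (stepNumber-zero k w (w ∸ k) (trans (+-suc (w ∸ k) k) (cong suc (m∸n+n≡m (≤-pred (<⇒≤ k<w)))))))
  (digits-horner (<-trans (n<1+n k) k<w) (n<1+n w) (n<1+n w) (s≤s (m∸n≤m w k)))
stepString-digits {B} x@(mkX a (suc k) 1≤a a<B k<a) = trans
  (cong (Vec.map toℕ ∘ digits B {{B≢0}})
    (stepNumber-pos a k (B ∸ suc k ∸ 1) (B ∸ a) B
      (m∸n+n≡m (<⇒≤ a<B))
      (trans (cong (_+ suc (suc k)) (trans (∸-+-assoc B (suc k) 1) (cong (B ∸_) (+-comm (suc k) 1)))) (m∸n+n≡m (≤-<-trans k<a a<B)))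
      1≤B))
  (digits-horner {{B≢0}} a<B (<-trans k<a a<B)
    (≤-<-trans (m∸n≤m (B ∸ suc k) 1) (∸-monoʳ-< {B} {suc k} {0} (s≤s z≤n) (<⇒≤ (≤-<-trans k<a a<B))))
    (∸-monoʳ-< {B} {a} {0} 1≤a (<⇒≤ a<B)))
  where
  B≢0 = base-nonZero x
  1≤B = <-trans 1≤a a<B

stepString-mixed : ∀ {B} (x : X B) → ¬ AllEqual (stepString x)
stepString-mixed {B} x (c , p≡c ∷ q≡c ∷ _) = leading-differ x
  (trans (sym (cong Vec.head ds)) (trans (cong toℕ (trans p≡c (sym q≡c))) (cong (Vec.head ∘ Vec.tail) ds)))
  where
  ds = stepString-digits x
  leading-differ : (x : X B) → Vec.head (stepDigits x) ≢ Vec.head (Vec.tail (stepDigits x))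
  leading-differ (mkX (suc k) zero     _ k<B _)   eq = <⇒≢ (∸-monoˡ-< k<B (s≤s z≤n)) eq
  leading-differ (mkX a       (suc k)  _ _   k<a) eq = <⇒≢ k<a (sym eq)

K : ∀ {B} → X B → X B
K x = differencePair (stepString x) (stepString-mixed x)

module _ (B : ℕ) where
  infix 4 _≡ₘ_
  _≡ₘ_ : ℤ → ℤ → Set
  i ≡ₘ j = + B ℤ.∣ i ℤ.- j

  -- Equality of the classes [ r ] = [ s ] in P B, where classes are
  -- represented by integers rather than by residues.
  _≡±_ : ℤ → ℤ → Set
  r ≡± s = r ≡ₘ s ⊎ r ≡ₘ ℤ.- s

  private
    via : ∀ {i j} → i ≡ j → + B ℤ.∣ i → + B ℤ.∣ j
    via = subst (+ B ℤ.∣_)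

  ≡±-refl : ∀ {r} → r ≡± r
  ≡±-refl {r} = inj₁ (via (sym (ℤ.+-inverseʳ r)) (divides 0ℤ refl))

  ≡±-sym : ∀ {r s} → r ≡± s → s ≡± r
  ≡±-sym {r} {s} (inj₁ p) = inj₁ (via (lemma r s) (ℤ.∣m⇒∣-m p))
    where lemma : ∀ r s → ℤ.- (r ℤ.- s) ≡ s ℤ.- r
          lemma = ℤ.solve-∀
  ≡±-sym {r} {s} (inj₂ p) = inj₂ (via (lemma r s) p)
    where lemma : ∀ r s → r ℤ.- (ℤ.- s) ≡ s ℤ.- (ℤ.- r)
          lemma = ℤ.solve-∀

  ≡±-trans : ∀ {r s t} → r ≡± s → s ≡± t → r ≡± t
  ≡±-trans {r} {s} {t} (inj₁ p) (inj₁ q) = inj₁ (via (lemma r s t) (ℤ.∣m∣n⇒∣m+n p q))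
    where lemma : ∀ r s t → (r ℤ.- s) ℤ.+ (s ℤ.- t) ≡ r ℤ.- t
          lemma = ℤ.solve-∀
  ≡±-trans {r} {s} {t} (inj₁ p) (inj₂ q) = inj₂ (via (lemma r s t) (ℤ.∣m∣n⇒∣m+n p q))
    where lemma : ∀ r s t → (r ℤ.- s) ℤ.+ (s ℤ.- (ℤ.- t)) ≡ r ℤ.- (ℤ.- t)
          lemma = ℤ.solve-∀
  ≡±-trans {r} {s} {t} (inj₂ p) (inj₁ q) = inj₂ (via (lemma r s t) (ℤ.∣m∣n⇒∣m-n p q))
    where lemma : ∀ r s t → (r ℤ.- (ℤ.- s)) ℤ.- (s ℤ.- t) ≡ r ℤ.- (ℤ.- t)
          lemma = ℤ.solve-∀
  ≡±-trans {r} {s} {t} (inj₂ p) (inj₂ q) = inj₁ (via (lemma r s t) (ℤ.∣m∣n⇒∣m-n p q))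
    where lemma : ∀ r s t → (r ℤ.- (ℤ.- s)) ℤ.- (s ℤ.- (ℤ.- t)) ≡ r ℤ.- t
          lemma = ℤ.solve-∀

  P : Setoid 0ℓ 0ℓ
  P = record
    { Carrier       = Σ[ r ∈ ℤ ] ¬ r ≡ₘ 0ℤ
    ; _≈_           = λ p q → proj₁ p ≡± proj₁ q
    ; isEquivalence = record
      { refl  = λ {p} → ≡±-refl {proj₁ p}
      ; sym   = λ {p} {q} → ≡±-sym {proj₁ p} {proj₁ q}
      ; trans = λ {p} {q} {t} → ≡±-trans {proj₁ p} {proj₁ q} {proj₁ t}
      }
    }

module _ {a ℓ} (S : Setoid a ℓ) where
  open Setoid S renaming (refl to ≈-refl; sym to ≈-sym; trans to ≈-trans)

  record TwoSubset : Set (a ⊔ ℓ) where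
    field
      fst snd  : Carrier
      distinct : ¬ fst ≈ snd

  open TwoSubset

  _≈₂_ : TwoSubset → TwoSubset → Set ℓ
  u ≈₂ v = (fst u ≈ fst v × snd u ≈ snd v) ⊎ (fst u ≈ snd v × snd u ≈ fst v)

  Choose₂ : Setoid (a ⊔ ℓ) ℓ
  Choose₂ = record
    { Carrier       = TwoSubset
    ; _≈_           = _≈₂_
    ; isEquivalence = record
      { refl  = inj₁ (≈-refl , ≈-refl)
      ; sym   = λ { (inj₁ (p , q)) → inj₁ (≈-sym p , ≈-sym q)
                  ; (inj₂ (p , q)) → inj₂ (≈-sym q , ≈-sym p) }
      ; trans = λ { (inj₁ (p , q)) (inj₁ (r , s)) → inj₁ (≈-trans p r , ≈-trans q s)
                  ; (inj₁ (p , q)) (inj₂ (r , s)) → inj₂ (≈-trans p r , ≈-trans q s)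
                  ; (inj₂ (p , q)) (inj₁ (r , s)) → inj₂ (≈-trans p s , ≈-trans q r)
                  ; (inj₂ (p , q)) (inj₂ (r , s)) → inj₁ (≈-trans p s , ≈-trans q r) }
      }
    }

open TwoSubset public

double : ℤ → ℤ
double r = + 2 ℤ.* r

module _ {B : ℕ} where

  private
    minus : ∀ r s → + 2 ℤ.* (r ℤ.- s) ≡ + 2 ℤ.* r ℤ.- + 2 ℤ.* s
    minus = ℤ.solve-∀
    plus : ∀ r s → + 2 ℤ.* (r ℤ.- (ℤ.- s)) ≡ + 2 ℤ.* r ℤ.- (ℤ.- (+ 2 ℤ.* s))
    plus = ℤ.solve-∀

  ∣-halve : Odd B → ∀ {i} → + B ℤ.∣ double i → + B ℤ.∣ i
  ∣-halve B-odd {i} p = subst (+ B ℤ.∣_)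
    (trans (cong (λ b → b ℤ.* i ℤ.- h ℤ.* double i) B≡1+2h) (lemma h i))
    (ℤ.∣m∣n⇒∣m-n (ℤ.∣m⇒∣m*n i ℤ.∣-refl) (ℤ.∣n⇒∣m*n h p))
    where
    h = + (B / 2)
    B≡1+2h : + B ≡ + 1 ℤ.+ h ℤ.* + 2
    B≡1+2h = trans (cong +_ (trans (m≡m%n+[m/n]*n B 2) (cong (_+ B / 2 * 2) B-odd)))
                   (trans (ℤ.pos-+ 1 (B / 2 * 2)) (cong (λ z → + 1 ℤ.+ z) (ℤ.pos-* (B / 2) 2)))
    lemma : ∀ h i → (+ 1 ℤ.+ h ℤ.* + 2) ℤ.* i ℤ.- h ℤ.* (+ 2 ℤ.* i) ≡ i
    lemma = ℤ.solve-∀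

  double-cong : ∀ r s → _≡±_ B r s → _≡±_ B (double r) (double s)
  double-cong r s = Sum.map
    (λ p → subst (+ B ℤ.∣_) (minus r s) (ℤ.∣n⇒∣m*n (+ 2) p))
    (λ p → subst (+ B ℤ.∣_) (plus r s) (ℤ.∣n⇒∣m*n (+ 2) p))

  double-injective : Odd B → ∀ r s → _≡±_ B (double r) (double s) → _≡±_ B r s
  double-injective B-odd r s = Sum.map
    (λ p → ∣-halve B-odd (subst (+ B ℤ.∣_) (sym (minus r s)) p))
    (λ p → ∣-halve B-odd (subst (+ B ℤ.∣_) (sym (plus r s)) p))

  rep : Setoid.Carrier (P B) → ℤ
  rep = proj₁

  doubleClass : Odd B → Setoid.Carrier (P B) → Setoid.Carrier (P B)
  doubleClass B-odd (r , r≢0) = double r , λ p →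
    r≢0 (∣-halve B-odd (subst (+ B ℤ.∣_) (sym (minus r 0ℤ)) p))

  δ : Odd B → Func (Choose₂ (P B)) (Choose₂ (P B))
  δ B-odd = record
    { to   = λ u → record
      { fst      = doubleClass B-odd (fst u)
      ; snd      = doubleClass B-odd (snd u)
      ; distinct = λ eq → distinct u (double-injective B-odd (rep (fst u)) (rep (snd u)) eq)
      }
    ; cong = λ {u} {v} → Sum.map
        (λ (p , q) → double-cong (rep (fst u)) (rep (fst v)) p , double-cong (rep (snd u)) (rep (snd v)) q)
        (λ (p , q) → double-cong (rep (fst u)) (rep (snd v)) p , double-cong (rep (snd u)) (rep (fst v)) q)
    }

halfSum halfDifference : ∀ {B} → X B → ℕ
halfSum        x = (d₁ x + d₂ x) / 2
halfDifference x = (d₁ x ∸ d₂ x) / 2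

-- The conditions under which Φ takes a value at x: both halves are
-- integers (so that _/_ is exact), their classes exist (neither is
-- divisible by B), and the two classes differ.
record ΦDefinedAt {B : ℕ} (x : X B) : Set where
  field
    2∣sum            : 2 ∣ d₁ x + d₂ x
    2∣difference     : 2 ∣ d₁ x ∸ d₂ x
    halfSum≢0        : ¬ _≡ₘ_ B (+ halfSum x) 0ℤ
    halfDifference≢0 : ¬ _≡ₘ_ B (+ halfDifference x) 0ℤ
    classes-distinct : ¬ _≡±_ B (+ halfSum x) (+ halfDifference x)

Φ : ∀ {B} → ((x : X B) → Stable x → ΦDefinedAt x) →
    Setoid.Carrier (𝒯 B) → Setoid.Carrier (Choose₂ (P B))
Φ defined (x , x-stable) = record
  { fst      = + halfSum x , ΦDefinedAt.halfSum≢0 (defined x x-stable)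
  ; snd      = + halfDifference x , ΦDefinedAt.halfDifference≢0 (defined x x-stable)
  ; distinct = ΦDefinedAt.classes-distinct (defined x x-stable)
  }

{-# OPTIONS --safe #-}

-- Every class [r] in P_B has exactly one representative among the odd numbers below B,
-- and ∣2d - B∣ is the one of [2d]. The digits produced from (d₁ , d₂) with d₂ > 0 are
-- d₁, B - d₁, d₂ - 1, B - d₂ - 1, so sorting them yields the differences ∣2d₁ - B∣ and
-- ∣2d₂ - B∣ in decreasing order as soon as these differ: K doubles the classes [d₁], [d₂].
-- The rotation (r , s) ↦ (r + s , r - s) takes Φ (d₁ , d₂) to {[d₁], [d₂]}, commutes with
-- doubling, and, its square being doubling, is injective for odd B. Hence bijectivity and
-- the conjugation can both be checked after rotating.

module Submission where

open import Data.Fin.Base using (toℕ)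
open import Data.Integer.Base as ℤ using (ℤ; +_; 0ℤ)
import Data.Integer.DivMod as ℤ
open import Data.Integer.Divisibility.Signed as ℤ using (divides)
import Data.Integer.Properties as ℤ
import Data.Integer.Tactic.RingSolver as ℤ
open import Data.List.Base as List using (List; []; _∷_)
open import Data.List.Relation.Binary.Equality.Propositional using (≋⇒≡)
open import Data.List.Relation.Binary.Permutation.Propositional as ↭
  using (_↭_; ↭-reflexive; ↭-sym; ↭-trans; ↭⇒↭ₛ)
import Data.List.Relation.Binary.Permutation.Propositional.Properties as ↭
open import Data.List.Relation.Unary.Linked using ([-]; _∷_)
import Data.List.Relation.Unary.Linked.Properties as Linked
open import Data.List.Relation.Unary.Sorted.TotalOrder.Properties using (↗↭↗⇒≋)
open import Data.Nat.Base
open import Data.Nat.Divisibility as ℕ using (_∣_; divides-refl)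
open import Data.Nat.DivMod
open import Data.Nat.ListAction.Properties using (sum-↭)
open import Data.Nat.Properties
open import Data.Nat.Tactic.RingSolver using (solve-∀)
open import Data.Product using (Σ-syntax; ∃; _×_; _,_; proj₁; proj₂)
open import Data.Sum as Sum using (_⊎_; inj₁; inj₂)
open import Data.Vec.Base using ([]; _∷_; toList)
open import Data.Vec.Properties using (toList-map)
open import Function using (Func; IsBijection)
open import Relation.Binary using (Setoid; tri<; tri≈; tri>)
import Relation.Binary.Construct.Flip.EqAndOrd as Flip
open import Relation.Binary.PropositionalEquality
open import Relation.Nullary using (¬_; contradiction)
open import Defs

-- Parity

even⊎odd : ∀ n → 2 ∣ n ⊎ Odd n
even⊎odd n with n % 2 in eq | m%n<n n 2
... | 0 | _ = inj₁ (ℕ.m%n≡0⇒n∣m n 2 eq)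
... | 1 | _ = inj₂ refl
... | suc (suc _) | s≤s (s≤s ())

even⇒¬odd : ∀ {n} → 2 ∣ n → ¬ Odd n
even⇒¬odd {n} 2∣n n-odd with () ← trans (sym n-odd) (ℕ.n∣m⇒m%n≡0 n 2 2∣n)

odd+odd⇒even : ∀ m n → Odd m → Odd n → 2 ∣ m + n
odd+odd⇒even m n m-odd n-odd =
  ℕ.m%n≡0⇒n∣m (m + n) 2 (trans (%-distribˡ-+ m n 2) (cong₂ (λ a b → (a + b) % 2) m-odd n-odd))

even∧m+n-odd⇒odd : ∀ {m n} → 2 ∣ m → Odd (m + n) → Odd n
even∧m+n-odd⇒odd {n = n} 2∣m = trans (sym (%-remove-+ˡ n 2∣m))

odd⇒0< : ∀ {n} → Odd n → 0 < n
odd⇒0< {suc n} _ = s≤s z≤n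

m+m-even : ∀ m → 2 ∣ m + m
m+m-even m = ℕ.divides m (lemma m)
  where lemma : ∀ m → m + m ≡ m * 2
        lemma = solve-∀

-- Sorting digits and taking differences

-- Any descending rearrangement serves as a witness, so the values of `K` can be found without
-- running the insertion sort.
data SortsTo (ms : List ℕ) : ℕ × ℕ → Set where
  sorted : ∀ {a b c e} → b ≤ a → c ≤ b → e ≤ c →
           ms ↭ a ∷ b ∷ c ∷ e ∷ [] → SortsTo ms (a ∸ e , b ∸ c)

SortsTo-resp-↭ : ∀ {ms ns o} → ms ↭ ns → SortsTo ns o → SortsTo ms o
SortsTo-resp-↭ p (sorted b≤a c≤b e≤c q) = sorted b≤a c≤b e≤c (↭-trans p q)

differences : ∀ {B} (s : DigitString B) {a b c e} → List.map toℕ (toList s) ≡ a ∷ b ∷ c ∷ e ∷ [] →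
              (outerDifference s , innerDifference s) ≡ (a ∸ e , b ∸ c)
differences (_ ∷ _ ∷ _ ∷ _ ∷ []) refl = refl

-- Two descending lists that are permutations of each other are equal, so the exhibited arrangement
-- is the one that `K` computes.
K-sorts : ∀ {B} (x : X B) {o} → SortsTo (toList (stepDigits x)) o → coordinates (K x) ≡ o
K-sorts x (sorted b≤a c≤b e≤c p) = differences t (≋⇒≡
  (↗↭↗⇒≋ (Flip.totalOrder ≤-totalOrder)
    (Linked.map⁺ (sortDescending-↘ s))
    (b≤a ∷ c≤b ∷ e≤c ∷ [-])
    (↭⇒↭ₛ (↭-trans (↭.map⁺ toℕ (sortDescending-↭ s))
      (↭-trans (↭-reflexive (trans (sym (toList-map toℕ s)) (cong toList (stepString-digits x)))) p)))))
  where
  s = stepString x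
  t = sortDescending s

-- Interleaving two pairs of numbers

-- Doubled and centred at B, the digits d₁, B - d₁, d₂ - 1, B - d₂ - 1 become ± u and - 2 ± v.
-- For u ≠ v of equal parity one of the intervals [- u , u] and [- 2 - v , - 2 + v]
-- contains the other, so that the shift by - 2 leaves the differences unchanged.
data Interleaving (u v : ℕ) : ℕ × ℕ → Set where
  outer< : u < v → Interleaving u v (v , u)
  outer> : v < u → Interleaving u v (u , v)
  tie    : u ≡ v → Interleaving u v (suc u , u ∸ 1)

equal-spreads⇒adjacent : ∀ p q u → p + (p + u) ≡ 2 + (q + (q + u)) → p ≡ suc q
equal-spreads⇒adjacent p q u eq = *-cancelʳ-≡ p (suc q) 2
  (+-cancelʳ-≡ u (p * 2) (suc q * 2) (trans (lemma₁ p u) (trans eq (lemma₂ q u))))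
  where
  lemma₁ : ∀ p u → p * 2 + u ≡ p + (p + u)
  lemma₁ = solve-∀
  lemma₂ : ∀ q u → 2 + (q + (q + u)) ≡ suc q * 2 + u
  lemma₂ = solve-∀

interleave : ∀ p u q v → p + (p + u) ≡ 2 + (q + (q + v)) → 0 < u →
             ∃ λ o → Interleaving u v o × SortsTo (p + u ∷ p ∷ q + v ∷ q ∷ []) o
interleave p u q v eq 0<u with <-cmp u v
... | tri< u<v _ _ = (v , u) , outer< u<v , subst (SortsTo _) (cong₂ _,_ (m+n∸m≡n q v) (m+n∸m≡n p u))
        (sorted p+u≤q+v (m≤m+n p u) (≤-trans (m≤n+m q 2) 2+q≤p)
          (↭-trans (↭.++-comm (p + u ∷ p ∷ []) (q + v ∷ q ∷ []))
            (↭.prep _ (↭.∷↭∷ʳ q (p + u ∷ p ∷ [])))))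
  where
  shift : ∀ q u → 1 + q + (1 + q + u) ≡ 2 + (q + (q + u))
  shift = solve-∀
  2+q≤p : 2 + q ≤ p
  2+q≤p = ≮⇒≥ λ p<2+q → let p≤1+q = ≤-pred p<2+q in <⇒≢ (begin-strict
    p + (p + u)           ≤⟨ +-mono-≤ p≤1+q (+-monoˡ-≤ u p≤1+q) ⟩
    1 + q + (1 + q + u)   ≡⟨ shift q u ⟩
    2 + (q + (q + u))     <⟨ +-monoʳ-< 2 (+-monoʳ-< q (+-monoʳ-< q u<v)) ⟩
    2 + (q + (q + v))     ∎) eq
    where open ≤-Reasoning
  p+u≤q+v : p + u ≤ q + v
  p+u≤q+v = ≮⇒≥ λ q+v<p+u → <⇒≢ (+-mono-≤-< 2+q≤p q+v<p+u) (sym eq)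
-- Now p = q + 1, and the order is q + 1 + u, q + u, q + 1, q. The middle comparison is where `0<u`
-- enters.
... | tri≈ _ refl _ with refl ← equal-spreads⇒adjacent p q u eq = (suc u , u ∸ 1) , tie refl ,
        subst (SortsTo _) (cong₂ _,_
          (trans (cong (_∸ q) (sym (+-suc q u))) (m+n∸m≡n q (suc u)))
          (trans (cong (q + u ∸_) (+-comm 1 q)) ([m+n]∸[m+o]≡n∸o q u 1)))
        (sorted (n≤1+n (q + u)) (subst (_≤ q + u) (+-comm q 1) (+-monoʳ-≤ q 0<u)) (n≤1+n q)
          (↭.prep _ (↭.swap _ _ ↭.refl)))
... | tri> _ _ v<u = (u , v) , outer> v<u , subst (SortsTo _) (cong₂ _,_ (m+n∸m≡n p u) (m+n∸m≡n q v))
        (sorted q+v≤p+u (m≤m+n q v) p≤q (↭.prep _ (↭.∷↭∷ʳ p (q + v ∷ q ∷ []))))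
  where
  shift : ∀ q v → 2 + (q + (q + v)) ≡ suc q + (suc q + v)
  shift = solve-∀
  p≤q : p ≤ q
  p≤q = ≮⇒≥ λ q<p → <⇒≢ (begin-strict
    2 + (q + (q + v))   ≡⟨ shift q v ⟩
    suc q + (suc q + v) <⟨ +-mono-≤-< q<p (+-mono-≤-< q<p v<u) ⟩
    p + (p + u)         ∎) (sym eq)
    where open ≤-Reasoning
  q+v≤p+u : q + v ≤ p + u
  q+v≤p+u = ≮⇒≥ λ p+u<q+v → <⇒≢ (<-≤-trans (+-mono-≤-< p≤q p+u<q+v) (m≤n+m _ 2)) eq

-- Here `p` is the smaller of the two numbers.
split-by-difference : ∀ m n → ∃ λ p → m + n ≡ p + (p + ∣ m - n ∣) × m ∷ n ∷ [] ↭ p + ∣ m - n ∣ ∷ p ∷ []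
split-by-difference m n with ≤-total m n
... | inj₁ m≤n = m , cong (_+_ m) (sym eq) ,
        ↭-trans (↭.swap m n ↭.refl) (↭-reflexive (cong (λ k → k ∷ m ∷ []) (sym eq)))
  where eq = trans (cong (_+_ m) (m≤n⇒∣m-n∣≡n∸m m≤n)) (m+[n∸m]≡n m≤n)
... | inj₂ n≤m = n , trans (+-comm m n) (cong (_+_ n) (sym eq)) ,
        ↭-reflexive (cong (λ k → k ∷ n ∷ []) (sym eq))
  where eq = trans (cong (_+_ n) (m≤n⇒∣n-m∣≡n∸m n≤m)) (m+[n∸m]≡n n≤m)

-- The list follows the order of the step digits for d₂ > 0: `m`, `n` stand for d₁, B - d₁ and `k`,
-- `l` for d₂ - 1, B - d₂ - 1.
interleave-differences : ∀ m n k l → m + n ≡ 2 + (k + l) → 0 < ∣ m - n ∣ →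
  ∃ λ o → Interleaving ∣ m - n ∣ ∣ k - l ∣ o × SortsTo (m ∷ k ∷ l ∷ n ∷ []) o
interleave-differences m n k l eq 0<u
  with p , m+n≡ , mn↭ ← split-by-difference m n | q , k+l≡ , kl↭ ← split-by-difference k l
  with o , i , s ← interleave p ∣ m - n ∣ q ∣ k - l ∣
         (trans (sym m+n≡) (trans eq (cong (_+_ 2) k+l≡))) 0<u
  = o , i , SortsTo-resp-↭ (↭-trans (↭.prep m (↭-sym (↭.∷↭∷ʳ n (k ∷ l ∷ [])))) (↭.++⁺ mn↭ kl↭)) s

∣m-n∣-odd : ∀ m n → Odd (m + n) → Odd ∣ m - n ∣
∣m-n∣-odd m n m+n-odd with p , m+n≡ , _ ← split-by-difference m n =
  even∧m+n-odd⇒odd (m+m-even p) (subst Odd (trans m+n≡ (sym (+-assoc p p _))) m+n-odd)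

-- The difference pair after one Kaprekar step

[m∸1]+[n∸m]≡n∸1 : ∀ {m n} → 1 ≤ m → m ≤ n → (m ∸ 1) + (n ∸ m) ≡ n ∸ 1
[m∸1]+[n∸m]≡n∸1 (s≤s _) m≤n = cong (_∸ 1) (m+[n∸m]≡n m≤n)

-- The digits d₁ - 1 and B - d₁ add up to B - 1, and the other two digits are both B - 1. Hence the
-- differences B - 1 - b and B - 1 - a are `a` and `b` again.
K-zero : ∀ {B} (x : X B) {a b} → d₂ x ≡ 0 → b ≤ a → d₁ x ∸ 1 ∷ B ∸ d₁ x ∷ [] ↭ a ∷ b ∷ [] →
         coordinates (K x) ≡ (a , b)
K-zero {B} x@(mkX d@(suc k) .0 _ d<B _) {a} {b} refl b≤a p = trans
  (K-sorts x (sorted ≤-refl (subst (a ≤_) a+b≡B∸1 (m≤m+n a b)) b≤a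
    (↭-trans (↭-sym (↭.shift k (B ∸ 1 ∷ B ∸ 1 ∷ []) (B ∸ d ∷ []))) (↭.++⁺ˡ (B ∸ 1 ∷ B ∸ 1 ∷ []) p))))
  (cong₂ _,_ (trans (cong (_∸ b) (sym a+b≡B∸1)) (m+n∸n≡m a b))
             (trans (cong (_∸ a) (sym a+b≡B∸1)) (m+n∸m≡n a b)))
  where
  open ≡-Reasoning
  a+b≡B∸1 : a + b ≡ B ∸ 1
  a+b≡B∸1 = begin
    a + b               ≡⟨ cong (_+_ a) (+-identityʳ b) ⟨
    a + (b + 0)         ≡⟨ sum-↭ p ⟨
    k + (B ∸ d + 0)     ≡⟨ cong (_+_ k) (+-identityʳ (B ∸ d)) ⟩
    k + (B ∸ d)         ≡⟨ [m∸1]+[n∸m]≡n∸1 (s≤s z≤n) (<⇒≤ d<B) ⟩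
    B ∸ 1               ∎

-- For d ≤ B this is ∣2d - B∣, written as the difference of the digits d and B - d.
spread : ℕ → ℕ → ℕ
spread B d = ∣ d - B ∸ d ∣

spread-odd : ∀ {B d} → Odd B → d ≤ B → Odd (spread B d)
spread-odd {B} {d} B-odd d≤B = ∣m-n∣-odd d (B ∸ d) (subst Odd (sym (m+[n∸m]≡n d≤B)) B-odd)

K-interleaves : ∀ {B} → Odd B → (x : X B) → 0 < d₂ x →
                Interleaving (spread B (d₁ x)) (spread B (d₂ x)) (coordinates (K x))
K-interleaves {B} B-odd x@(mkX a (suc k) _ a<B k<a) _ =
  -- Here `k` is d₂ - 1. The spread of d₁ is odd and therefore positive.
  let o , i , s = interleave-differences a (B ∸ a) k (B ∸ suc k ∸ 1) sums
                    (odd⇒0< (spread-odd B-odd (<⇒≤ a<B)))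
  -- Lowering both d₂ and B - d₂ by one does not change their difference.
  in subst₂ (Interleaving (spread B a)) (sym (∣1+m-n∣ k (B ∸ suc k) 0<B∸d₂)) (sym (K-sorts x s)) i
  where
  0<B∸d₂ = m<n⇒0<n∸m (≤-<-trans k<a a<B)
  ∣1+m-n∣ : ∀ m n → 0 < n → ∣ suc m - n ∣ ≡ ∣ m - n ∸ 1 ∣
  ∣1+m-n∣ m (suc n) _ = refl
  sums : a + (B ∸ a) ≡ 2 + (k + (B ∸ suc k ∸ 1))
  sums = begin
    a + (B ∸ a)                 ≡⟨ m+[n∸m]≡n (<⇒≤ a<B) ⟩
    B                           ≡⟨ m+[n∸m]≡n (<⇒≤ (≤-<-trans k<a a<B)) ⟨
    suc k + (B ∸ suc k)         ≡⟨ cong (_+_ (suc k)) (m+[n∸m]≡n 0<B∸d₂) ⟨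
    suc k + suc (B ∸ suc k ∸ 1) ≡⟨ +-suc (suc k) _ ⟩
    2 + (k + (B ∸ suc k ∸ 1))   ∎
    where open ≡-Reasoning

stable : ∀ {B} {x : X B} {a b} → coordinates x ≡ (a , b) → b < a → Odd a → Odd b → Stable x
stable refl b<a a-odd b-odd = mkStable b<a (odd⇒0< b-odd) a-odd b-odd

-- Rotating pairs of classes up to sign

coordinatesℤ : ∀ {B} → X B → ℤ × ℤ
coordinatesℤ x = + d₁ x , + d₂ x

-- Defined on integer pairs because the class of a sum depends on the chosen signs; only the
-- unordered pair of sum and difference is independent of them.
rotate : ℤ × ℤ → ℤ × ℤ
rotate (r , s) = r ℤ.+ s , r ℤ.- s

module _ {B : ℕ} where

  infix 4 _≈_ _≡±₂_

  _≈_ : ℤ → ℤ → Set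
  _≈_ = _≡±_ B

  -- Agrees with equality in `Choose₂ (P B)` on representatives, but applies to rotated pairs before
  -- their classes are known to be nonzero and distinct.
  _≡±₂_ : ℤ × ℤ → ℤ × ℤ → Set
  (r , s) ≡±₂ (r′ , s′) = (r ≈ r′ × s ≈ s′) ⊎ (r ≈ s′ × s ≈ r′)

  ≡ₘ-+ : ∀ r s j k {t} → + B ℤ.∣ r ℤ.- j → + B ℤ.∣ s ℤ.- k → j ℤ.+ k ≡ t → + B ℤ.∣ (r ℤ.+ s) ℤ.- t
  ≡ₘ-+ r s j k p q refl = subst (ℤ._∣_ (+ B)) (lemma r s j k) (ℤ.∣m∣n⇒∣m+n p q)
    where
    lemma : ∀ r s j k → (r ℤ.- j) ℤ.+ (s ℤ.- k) ≡ (r ℤ.+ s) ℤ.- (j ℤ.+ k)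
    lemma = ℤ.solve-∀

  ≡ₘ-∸ : ∀ r s j k {t} → + B ℤ.∣ r ℤ.- j → + B ℤ.∣ s ℤ.- k → j ℤ.- k ≡ t → + B ℤ.∣ (r ℤ.- s) ℤ.- t
  ≡ₘ-∸ r s j k p q refl = subst (ℤ._∣_ (+ B)) (lemma r s j k) (ℤ.∣m∣n⇒∣m-n p q)
    where
    lemma : ∀ r s j k → (r ℤ.- j) ℤ.- (s ℤ.- k) ≡ (r ℤ.- s) ℤ.- (j ℤ.- k)
    lemma = ℤ.solve-∀

  ≈-reflexive : ∀ {r s} → r ≡ s → r ≈ s
  ≈-reflexive {r} refl = ≡±-refl B {r}

  ≈-neg : ∀ {r s} → r ≡ ℤ.- s → r ≈ s
  ≈-neg {s = s} refl = inj₂ (subst (ℤ._∣_ (+ B)) (sym (ℤ.+-inverseʳ (ℤ.- s))) (divides 0ℤ refl))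

  -- Changing the sign of one entry exchanges sum and difference up to sign; changing both signs
  -- negates each of them.
  rotate-cong₁ : ∀ r s j k → r ≈ j × s ≈ k → rotate (r , s) ≡±₂ rotate (j , k)
  rotate-cong₁ r s j k (inj₁ p , inj₁ q) =
    inj₁ (inj₁ (≡ₘ-+ r s j k p q refl) , inj₁ (≡ₘ-∸ r s j k p q refl))
  rotate-cong₁ r s j k (inj₁ p , inj₂ q) =
    inj₂ (inj₁ (≡ₘ-+ r s j (ℤ.- k) p q refl) ,
          inj₁ (≡ₘ-∸ r s j (ℤ.- k) p q (cong (ℤ._+_ j) (ℤ.neg-involutive k))))
  rotate-cong₁ r s j k (inj₂ p , inj₁ q) =
    inj₂ (inj₂ (≡ₘ-+ r s (ℤ.- j) k p q
            (trans (cong (ℤ._+_ (ℤ.- j)) (sym (ℤ.neg-involutive k))) (sym (ℤ.neg-distrib-+ j (ℤ.- k))))) ,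
          inj₂ (≡ₘ-∸ r s (ℤ.- j) k p q (sym (ℤ.neg-distrib-+ j k))))
  rotate-cong₁ r s j k (inj₂ p , inj₂ q) =
    inj₁ (inj₂ (≡ₘ-+ r s (ℤ.- j) (ℤ.- k) p q (sym (ℤ.neg-distrib-+ j k))) ,
          inj₂ (≡ₘ-∸ r s (ℤ.- j) (ℤ.- k) p q (sym (ℤ.neg-distrib-+ j (ℤ.- k)))))

  rotate-cong : ∀ p q → p ≡±₂ q → rotate p ≡±₂ rotate q
  rotate-cong (r , s) (j , k) (inj₁ pq) = rotate-cong₁ r s j k pq
  rotate-cong (r , s) (j , k) (inj₂ (p , q)) = Sum.map
    (λ (a , b) → ≡±-trans B {r ℤ.+ s} {k ℤ.+ j} {j ℤ.+ k} a +-swap ,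
                  ≡±-trans B {r ℤ.- s} {k ℤ.- j} {j ℤ.- k} b ∸-swap)
    (λ (a , b) → ≡±-trans B {r ℤ.+ s} {k ℤ.- j} {j ℤ.- k} a ∸-swap ,
                  ≡±-trans B {r ℤ.- s} {k ℤ.+ j} {j ℤ.+ k} b +-swap)
    (rotate-cong₁ r s k j (p , q))
    where
    +-swap : k ℤ.+ j ≈ j ℤ.+ k
    +-swap = ≈-reflexive (ℤ.+-comm k j)
    lemma : ∀ j k → k ℤ.- j ≡ ℤ.- (j ℤ.- k)
    lemma = ℤ.solve-∀
    ∸-swap : k ℤ.- j ≈ j ℤ.- k
    ∸-swap = ≈-neg {s = j ℤ.- k} (lemma j k)

  rotate-rotate : ∀ r s → rotate (rotate (r , s)) ≡ (double r , double s)
  rotate-rotate r s = cong₂ _,_ (sum r s) (difference r s)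
    where
    sum : ∀ r s → (r ℤ.+ s) ℤ.+ (r ℤ.- s) ≡ + 2 ℤ.* r
    sum = ℤ.solve-∀
    difference : ∀ r s → (r ℤ.+ s) ℤ.- (r ℤ.- s) ≡ + 2 ℤ.* s
    difference = ℤ.solve-∀

  rotate-injective : Odd B → ∀ p q → rotate p ≡±₂ rotate q → p ≡±₂ q
  rotate-injective B-odd (r , s) (r′ , s′) eq = Sum.map
    (λ (p , q) → double-injective B-odd r r′ p , double-injective B-odd s s′ q)
    (λ (p , q) → double-injective B-odd r s′ p , double-injective B-odd s r′ q)
    (subst₂ _≡±₂_ (rotate-rotate r s) (rotate-rotate r′ s′)
      (rotate-cong (rotate (r , s)) (rotate (r′ , s′)) eq))

  -- Representatives of classes and the rotated pair

  -- The spread is B - 2d or 2d - B, which is -2d or 2d modulo B.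
  spread≈double : ∀ {d} → d ≤ B → + spread B d ≈ double (+ d)
  spread≈double {d} d≤B with ≤-total d (B ∸ d)
  ... | inj₁ d≤e = inj₂ (subst (ℤ._∣_ (+ B)) (sym (trans (lemma (+ d) (+ spread B d)) (cong +_ eq))) ℤ.∣-refl)
    where
    lemma : ∀ m u → u ℤ.- ℤ.- (+ 2 ℤ.* m) ≡ m ℤ.+ (u ℤ.+ m)
    lemma = ℤ.solve-∀
    eq : d + (spread B d + d) ≡ B
    eq = trans (cong (λ u → d + (u + d)) (m≤n⇒∣m-n∣≡n∸m d≤e))
               (trans (cong (_+_ d) (m∸n+n≡m d≤e)) (m+[n∸m]≡n d≤B))
  ... | inj₂ e≤d = inj₁ (subst (ℤ._∣_ (+ B)) (sym (begin
      + u ℤ.- double (+ d)        ≡⟨ cong (λ n → + u ℤ.- double (+ n)) e+u≡d ⟨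
      + u ℤ.- double (+ (e + u))  ≡⟨ lemma (+ u) (+ e) ⟩
      ℤ.- (+ (e + (e + u)))       ≡⟨ cong (λ n → ℤ.- (+ n)) (trans (cong (_+_ e) e+u≡d) (m∸n+n≡m d≤B)) ⟩
      ℤ.- (+ B)                   ∎)) (ℤ.∣m⇒∣-m ℤ.∣-refl))
    where
    open ≡-Reasoning
    u = spread B d
    e = B ∸ d
    lemma : ∀ u e → u ℤ.- + 2 ℤ.* (e ℤ.+ u) ≡ ℤ.- (e ℤ.+ (e ℤ.+ u))
    lemma = ℤ.solve-∀
    e+u≡d : e + u ≡ d
    e+u≡d = trans (cong (_+_ e) (m≤n⇒∣n-m∣≡n∸m e≤d)) (m+[n∸m]≡n e≤d)

  ∣∧<⇒≡0 : ∀ {n} → B ∣ n → n < B → n ≡ 0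
  ∣∧<⇒≡0 {zero}  _   _   = refl
  ∣∧<⇒≡0 {suc n} B∣n n<B = contradiction B∣n (ℕ.>⇒∤ n<B)

  ∣∧<2B⇒≡B : ∀ {n} → B ∣ n → 0 < n → n < B + B → n ≡ B
  ∣∧<2B⇒≡B (divides-refl 1) _ _ = +-identityʳ B
  ∣∧<2B⇒≡B (divides-refl (suc (suc q))) _ n<2B =
    contradiction n<2B (≤⇒≯ (+-monoʳ-≤ B (m≤m+n B (q * B))))

  -- If a and b agree modulo B, their size makes them equal. If they are opposite, B divides a + b,
  -- which lies strictly between 0 and 2B, so the even number a + b would be the odd number B.
  even-sum-unique : Odd B → ∀ {a b} → 0 < a → a < B → b < B → 2 ∣ a + b → + a ≈ + b → a ≡ b
  even-sum-unique _ {a} {b} _ a<B b<B _ (inj₁ p) =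
    ℤ.+-injective (ℤ.i-j≡0⇒i≡j (+ a) (+ b) (ℤ.∣i∣≡0⇒i≡0
    (∣∧<⇒≡0 (ℤ.∣⇒∣ᵤ p) (subst (λ i → ℤ.∣ i ∣ < B) (sym (ℤ.m-n≡m⊖n a b))
        (≤-<-trans (ℤ.∣m⊝n∣≤m⊔n a b) (⊔-pres-<m a<B b<B))))))
  even-sum-unique B-odd {a} {b} 0<a a<B b<B 2∣a+b (inj₂ p) =
    contradiction (subst Odd (sym a+b≡B) B-odd) (even⇒¬odd 2∣a+b)
    where
    a+b≡B : a + b ≡ B
    a+b≡B = ∣∧<2B⇒≡B (subst (λ j → B ∣ ℤ.∣ + a ℤ.+ j ∣) (ℤ.neg-involutive (+ b)) (ℤ.∣⇒∣ᵤ p))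
      (≤-trans 0<a (m≤m+n a b)) (+-mono-< a<B b<B)

  odd-unique : Odd B → ∀ {a b} → a < B → b < B → Odd a → Odd b → + a ≈ + b → a ≡ b
  odd-unique B-odd {a} {b} a<B b<B a-odd b-odd =
    even-sum-unique B-odd (odd⇒0< a-odd) a<B b<B (odd+odd⇒even a b a-odd b-odd)

  -- This and the next two lemmas show that, for odd B, the rotated classes coincide exactly when
  -- `r` or `s` is zero modulo B. Rotation thus trades nonzero classes for distinct ones.
  ∣ˡ⇒sum≈difference : ∀ r s → + B ℤ.∣ r → r ℤ.+ s ≈ r ℤ.- s
  ∣ˡ⇒sum≈difference r s p = inj₂ (subst (ℤ._∣_ (+ B)) (lemma r s) (ℤ.∣n⇒∣m*n (+ 2) p))
    where
    lemma : ∀ r s → + 2 ℤ.* r ≡ (r ℤ.+ s) ℤ.- ℤ.- (r ℤ.- s)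
    lemma = ℤ.solve-∀

  ∣ʳ⇒sum≈difference : ∀ r s → + B ℤ.∣ s → r ℤ.+ s ≈ r ℤ.- s
  ∣ʳ⇒sum≈difference r s p = inj₁ (subst (ℤ._∣_ (+ B)) (lemma r s) (ℤ.∣n⇒∣m*n (+ 2) p))
    where
    lemma : ∀ r s → + 2 ℤ.* s ≡ (r ℤ.+ s) ℤ.- (r ℤ.- s)
    lemma = ℤ.solve-∀

  sum≈difference⇒∣ : Odd B → ∀ r s → r ℤ.+ s ≈ r ℤ.- s → + B ℤ.∣ r ⊎ + B ℤ.∣ s
  sum≈difference⇒∣ B-odd r s (inj₁ p) = inj₂ (∣-halve B-odd (subst (ℤ._∣_ (+ B)) (lemma r s) p))
    where
    lemma : ∀ r s → (r ℤ.+ s) ℤ.- (r ℤ.- s) ≡ + 2 ℤ.* s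
    lemma = ℤ.solve-∀
  sum≈difference⇒∣ B-odd r s (inj₂ p) = inj₁ (∣-halve B-odd (subst (ℤ._∣_ (+ B)) (lemma r s) p))
    where
    lemma : ∀ r s → (r ℤ.+ s) ℤ.- ℤ.- (r ℤ.- s) ≡ + 2 ℤ.* r
    lemma = ℤ.solve-∀

  rotate-halves : (x : X B) → Stable x → 2 ∣ d₁ x + d₂ x × 2 ∣ d₁ x ∸ d₂ x ×
           rotate (+ halfSum x , + halfDifference x) ≡ coordinatesℤ x
  rotate-halves (mkX a b _ _ b≤a) (mkStable _ _ a-odd b-odd) = 2∣sum , 2∣diff ,
    cong₂ _,_ (cong +_ r+s≡a) (trans (cong (λ n → + n ℤ.- + s) (sym s+b≡r)) (lemma (+ s) (+ b)))
    where
    open ≡-Reasoning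
    2∣sum = odd+odd⇒even a b a-odd b-odd
    2∣diff : 2 ∣ a ∸ b
    2∣diff = ℕ.∣m+n∣m⇒∣n
      (subst (2 ∣_) (trans (+-comm a b) (trans (cong (_+_ b) (sym (m+[n∸m]≡n b≤a))) (sym (+-assoc b b _)))) 2∣sum)
      (m+m-even b)
    r = (a + b) / 2
    s = (a ∸ b) / 2
    r*2 : r * 2 ≡ a + b
    r*2 = m/n*n≡m 2∣sum
    s*2 : s * 2 ≡ a ∸ b
    s*2 = m/n*n≡m 2∣diff
    double-ℕ : ∀ n → n + n ≡ n * 2
    double-ℕ = solve-∀
    r+s≡a : r + s ≡ a
    r+s≡a = *-cancelʳ-≡ (r + s) a 2 (begin
      (r + s) * 2         ≡⟨ *-distribʳ-+ 2 r s ⟩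
      r * 2 + s * 2       ≡⟨ cong₂ _+_ r*2 s*2 ⟩
      a + b + (a ∸ b)     ≡⟨ +-assoc a b (a ∸ b) ⟩
      a + (b + (a ∸ b))   ≡⟨ cong (_+_ a) (m+[n∸m]≡n b≤a) ⟩
      a + a               ≡⟨ double-ℕ a ⟩
      a * 2               ∎)
    s+b≡r : s + b ≡ r
    s+b≡r = *-cancelʳ-≡ (s + b) r 2 (begin
      (s + b) * 2         ≡⟨ *-distribʳ-+ 2 s b ⟩
      s * 2 + b * 2       ≡⟨ cong₂ _+_ s*2 (sym (double-ℕ b)) ⟩
      a ∸ b + (b + b)     ≡⟨ +-assoc (a ∸ b) b b ⟨
      a ∸ b + b + b       ≡⟨ cong (_+ b) (m∸n+n≡m b≤a) ⟩
      a + b               ≡⟨ r*2 ⟨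
      r * 2               ∎)
    lemma : ∀ s b → s ℤ.+ b ℤ.- s ≡ b
    lemma = ℤ.solve-∀

  -- The remainder k of z and B - k lie in the same class up to sign, and one of them is odd because
  -- their sum is.
  oddRepresentative : Odd B → ∀ z → ¬ + B ℤ.∣ z → ∃ λ d → d < B × Odd d × + d ≈ z
  oddRepresentative B-odd z B∤z = representative (even⊎odd k)
    where
    instance _ = >-nonZero (odd⇒0< B-odd)
    k = z ℤ.%ℕ B
    q = z ℤ./ℕ B
    z≡ : z ≡ + k ℤ.+ q ℤ.* + B
    z≡ = ℤ.a≡a%ℕn+[a/ℕn]*n z B
    k<B : k < B
    k<B = ℤ.n%ℕd<d z B
    k≢0 : k ≢ 0
    k≢0 k≡0 = B∤z (divides q (trans z≡ (trans (cong (λ n → + n ℤ.+ q ℤ.* + B) k≡0) (ℤ.+-identityˡ _))))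
    representative : 2 ∣ k ⊎ Odd k → ∃ λ d → d < B × Odd d × + d ≈ z
    representative (inj₂ k-odd) = k , k<B , k-odd ,
      inj₁ (divides (ℤ.- q) (trans (cong (ℤ._-_ (+ k)) z≡) (lemma (+ k) q (+ B))))
      where
      lemma : ∀ k q b → k ℤ.- (k ℤ.+ q ℤ.* b) ≡ (ℤ.- q) ℤ.* b
      lemma = ℤ.solve-∀
    representative (inj₁ 2∣k) = B ∸ k , ∸-monoʳ-< {B} {k} {0} (n≢0⇒n>0 k≢0) (<⇒≤ k<B) ,
      even∧m+n-odd⇒odd 2∣k (subst Odd (sym (m+[n∸m]≡n (<⇒≤ k<B))) B-odd) ,
      inj₂ (divides (+ 1 ℤ.+ q) (begin
        + (B ∸ k) ℤ.- ℤ.- z                         ≡⟨ cong (λ i → + (B ∸ k) ℤ.- ℤ.- i) z≡ ⟩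
        + (B ∸ k) ℤ.- ℤ.- (+ k ℤ.+ q ℤ.* + B)       ≡⟨ lemma₁ (+ (B ∸ k)) (+ k) q (+ B) ⟩
        (+ (B ∸ k) ℤ.+ + k) ℤ.+ q ℤ.* + B           ≡⟨ cong (λ n → + n ℤ.+ q ℤ.* + B) (m∸n+n≡m (<⇒≤ k<B)) ⟩
        + B ℤ.+ q ℤ.* + B                           ≡⟨ lemma₂ q (+ B) ⟩
        (+ 1 ℤ.+ q) ℤ.* + B                         ∎))
      where
      open ≡-Reasoning
      lemma₁ : ∀ d k q b → d ℤ.- ℤ.- (k ℤ.+ q ℤ.* b) ≡ (d ℤ.+ k) ℤ.+ q ℤ.* b
      lemma₁ = ℤ.solve-∀
      lemma₂ : ∀ q b → b ℤ.+ q ℤ.* b ≡ (+ 1 ℤ.+ q) ℤ.* b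
      lemma₂ = ℤ.solve-∀

  -- Doubling under the Kaprekar map

  stable-interleaving : ∀ {y : X B} {u v r s} → Interleaving u v (coordinates y) → Odd u → Odd v → u ≢ v →
                        + u ≈ r → + v ≈ s → Stable y × coordinatesℤ y ≡±₂ (r , s)
  stable-interleaving (outer< u<v) u-odd v-odd _ p q = mkStable u<v (odd⇒0< u-odd) v-odd u-odd , inj₂ (q , p)
  stable-interleaving (outer> v<u) u-odd v-odd _ p q = mkStable v<u (odd⇒0< v-odd) u-odd v-odd , inj₁ (p , q)
  stable-interleaving (tie u≡v)    _     _     u≢v _ _ = contradiction u≡v u≢v

  -- Only the sum of the coordinates has to be even, so that this also covers the pairs left by a
  -- tie, whose coordinates are both even.
  K-doubles : Odd B → (x : X B) → 0 < d₂ x → d₂ x < d₁ x → 2 ∣ d₁ x + d₂ x →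
              Stable (K x) × coordinatesℤ (K x) ≡±₂ (double (+ d₁ x) , double (+ d₂ x))
  K-doubles B-odd x@(mkX a b 1≤a a<B b≤a) 0<b b<a 2∣a+b =
    stable-interleaving {r = double (+ a)} {double (+ b)} (K-interleaves B-odd x 0<b)
      (spread-odd B-odd a≤B) (spread-odd B-odd b≤B)
      -- Equal spreads would give [2d₁] = [2d₂], hence [d₁] = [d₂] since B is odd, and then d₁ = d₂.
      (λ u≡v → <⇒≢ b<a (sym (even-sum-unique B-odd 1≤a a<B (<-trans b<a a<B) 2∣a+b
        (double-injective B-odd (+ a) (+ b)
          (≡±-trans B {double (+ a)} {+ spread B b} {double (+ b)}
            (≡±-sym B {+ spread B b} {double (+ a)} (subst (λ n → + n ≈ double (+ a)) u≡v (spread≈double a≤B)))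
            (spread≈double b≤B))))))
      (spread≈double a≤B) (spread≈double b≤B)
    where
    a≤B = <⇒≤ a<B
    b≤B = ≤-trans b≤a a≤B

  stable-K-doubles : Odd B → (x : X B) → Stable x →
    Stable (K x) × coordinatesℤ (K x) ≡±₂ (double (+ d₁ x) , double (+ d₂ x))
  stable-K-doubles B-odd x (mkStable d₂<d₁ 0<d₂ d₁-odd d₂-odd) =
    K-doubles B-odd x 0<d₂ d₂<d₁ (odd+odd⇒even (d₁ x) (d₂ x) d₁-odd d₂-odd)

  K-stable : Odd B → (x : X B) → Stable x → Stable (K x)
  K-stable B-odd x x-stable = proj₁ (stable-K-doubles B-odd x x-stable)

-- Reaching the stable region in three steps

-- The only pairs with d₂ = 0 that occur as values of K: (2 , 0) from a tie u = v = 1,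
-- and (B - 1 , 0) from (1 , 0).
K-stable-zero : ∀ {B} → 3 < B → Odd B → (x : X B) → d₂ x ≡ 0 → d₁ x ≡ 2 ⊎ d₁ x ≡ B ∸ 1 → Stable (K x)
K-stable-zero (s≤s (s≤s (s≤s (s≤s _)))) B-odd x@(mkX _ _ _ _ _) d₂≡0 (inj₁ refl) =
  stable (K-zero x d₂≡0 (s≤s z≤n) (↭.swap _ _ ↭.refl)) (s≤s (s≤s z≤n)) B-odd refl
K-stable-zero {B} (s≤s (s≤s (s≤s (s≤s {n = m} _)))) B-odd x@(mkX _ _ _ _ _) d₂≡0 (inj₂ refl) =
  stable (K-zero x d₂≡0 (s≤s z≤n) (↭.prep _ (↭-reflexive (cong (_∷ []) (m+n∸n≡m 1 (3 + m)))))) (s≤s (s≤s z≤n)) B-odd refl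

-- For u = 1 the pair is (2 , 0). For larger odd u both coordinates are even, positive and distinct,
-- so `K-doubles` applies.
K-stable-tie : ∀ {B} → 3 < B → Odd B → (x : X B) {u : ℕ} → coordinates x ≡ (suc u , u ∸ 1) → Odd u → Stable (K x)
K-stable-tie 3<B B-odd x {1}           refl _     = K-stable-zero 3<B B-odd x refl (inj₁ refl)
K-stable-tie 3<B B-odd x {suc (suc u)} refl u-odd =
  proj₁ (K-doubles B-odd x (s≤s z≤n) (n≤1+n (2 + u))
    (subst (2 ∣_) (+-suc (2 + u) (suc u)) (odd+odd⇒even (2 + u) (2 + u) u-odd u-odd)))

-- Both spreads are odd, so `K x` is already stable unless they tie, and a tie is resolved by the
-- second step.
K²-stable : ∀ {B} → 3 < B → Odd B → (x : X B) → 0 < d₂ x → Stable (K (K x))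
K²-stable {B} 3<B B-odd x@(mkX a b _ a<B b≤a) 0<b =
  cases (K-interleaves B-odd x 0<b) refl (spread-odd B-odd (<⇒≤ a<B)) (spread-odd B-odd (<⇒≤ (≤-<-trans b≤a a<B)))
  where
  cases : ∀ {u v o} → Interleaving u v o → coordinates (K x) ≡ o → Odd u → Odd v → Stable (K (K x))
  cases (outer< u<v) eq u-odd v-odd = K-stable B-odd (K x) (stable eq u<v v-odd u-odd)
  cases (outer> v<u) eq u-odd v-odd = K-stable B-odd (K x) (stable eq v<u u-odd v-odd)
  cases (tie _)      eq u-odd _     = K-stable-tie 3<B B-odd (K x) eq u-odd

-- If d₂ = 0, then `K x` consists of d₁ - 1 and B - d₁ in decreasing order. Either the smaller one
-- is positive and two more steps suffice, or `K x` is (B - 1 , 0).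
K³-stable : ∀ {B} → 3 < B → Odd B → (x : X B) → Stable (K (K (K x)))
K³-stable {B} 3<B B-odd x = d₂-cases (d₂ x) refl
  where
  p-cases : ∀ p {u} → p + (p + u) ≡ B ∸ 1 → coordinates (K x) ≡ (p + u , p) → Stable (K (K (K x)))
  p-cases zero    u≡ eq = K-stable B-odd (K (K x))
    (K-stable-zero 3<B B-odd (K x) (cong proj₂ eq) (inj₂ (trans (cong proj₁ eq) u≡)))
  p-cases (suc p) _  eq = K²-stable 3<B B-odd (K x) (subst (0 <_) (sym (cong proj₂ eq)) (s≤s z≤n))
  d₂-cases : ∀ k → d₂ x ≡ k → Stable (K (K (K x)))
  d₂-cases (suc k) d₂≡ = K-stable B-odd (K (K x)) (K²-stable 3<B B-odd x (subst (0 <_) (sym d₂≡) (s≤s z≤n)))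
  d₂-cases zero    d₂≡ =
    let p , sum≡ , p↭ = split-by-difference (d₁ x ∸ 1) (B ∸ d₁ x)
    in p-cases p (trans (sym sum≡) ([m∸1]+[n∸m]≡n∸1 (X.1≤d₁ x) (<⇒≤ (X.d₁<B x)))) (K-zero x d₂≡ (m≤m+n p _) p↭)

-- The bijection and the conjugation

-- A half divisible by B would put d₁ and d₂ in one class, impossible for distinct odd numbers below
-- B. Coinciding classes of the halves would make B divide their difference d₂ or their sum d₁.
Φ-defined : ∀ {B} → Odd B → (x : X B) → Stable x → ΦDefinedAt x
Φ-defined {B} B-odd x x-stable@(mkStable d₂<d₁ 0<d₂ d₁-odd d₂-odd)
  with 2∣sum , 2∣diff , rs ← rotate-halves x x-stable = record
  { 2∣sum            = 2∣sum
  ; 2∣difference     = 2∣diff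
  ; halfSum≢0        = λ p → d₁≉d₂ (∣ˡ⇒sum≈difference (+ r) (+ s) (subst (ℤ._∣_ (+ B)) (ℤ.+-identityʳ (+ r)) p))
  ; halfDifference≢0 = λ p → d₁≉d₂ (∣ʳ⇒sum≈difference (+ r) (+ s) (subst (ℤ._∣_ (+ B)) (ℤ.+-identityʳ (+ s)) p))
  ; classes-distinct = λ where
      (inj₁ p) → contradiction (ℤ.∣⇒∣ᵤ (subst (ℤ._∣_ (+ B)) (cong proj₂ rs) p)) (ℕ.>⇒∤ {{>-nonZero 0<d₂}} d₂<B)
      (inj₂ p) → contradiction
        (ℤ.∣⇒∣ᵤ (subst (ℤ._∣_ (+ B)) (trans (cong (ℤ._+_ (+ r)) (ℤ.neg-involutive (+ s))) (cong proj₁ rs)) p))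
        (ℕ.>⇒∤ {{>-nonZero (X.1≤d₁ x)}} (X.d₁<B x))
  }
  where
  r = halfSum x
  s = halfDifference x
  d₂<B = <-trans d₂<d₁ (X.d₁<B x)
  d₁≉d₂ : ¬ + r ℤ.+ + s ≈ + r ℤ.- + s
  d₁≉d₂ eq = <⇒≢ d₂<d₁ (sym (odd-unique B-odd (X.d₁<B x) d₂<B d₁-odd d₂-odd
    (subst (λ (i , j) → _≡±_ B i j) (proj₂ (proj₂ (rotate-halves x x-stable))) eq)))

module _ {B : ℕ} (B-odd : Odd B) where

  open Setoid (𝒯 B) using () renaming (Carrier to T; _≈_ to _≈T_)
  open Setoid (Choose₂ (P B)) using () renaming (Carrier to C; _≈_ to _≈C_)

  representatives : C → ℤ × ℤ
  representatives c = rep (fst c) , rep (snd c)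

  φ : T → C
  φ = Φ (Φ-defined B-odd)

  rotate-φ : ∀ x → rotate (representatives (φ x)) ≡ coordinatesℤ (proj₁ x)
  rotate-φ (x , x-stable) = proj₂ (proj₂ (rotate-halves x x-stable))

  -- Injectivity of rotation reduces an equation for `φ x` to one for d₁ and d₂. Congruence,
  -- surjectivity and the conjugation all pass through here.
  rotate-determines-φ : ∀ x c → _≡±₂_ {B} (coordinatesℤ (proj₁ x)) (rotate (representatives c)) → φ x ≈C c
  rotate-determines-φ x c eq = rotate-injective B-odd (representatives (φ x)) (representatives c)
    (subst (λ p → _≡±₂_ {B} p (rotate (representatives c))) (sym (rotate-φ x)) eq)

  φ-cong : ∀ {x y} → x ≈T y → φ x ≈C φ y
  φ-cong {x} {y} refl = rotate-determines-φ x (φ y)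
    (subst (_≡±₂_ {B} (coordinatesℤ (proj₁ y))) (sym (rotate-φ y))
      (inj₁ (≡±-refl B {+ d₁ (proj₁ y)} , ≡±-refl B {+ d₂ (proj₁ y)})))

  φ-injective : ∀ {x y} → φ x ≈C φ y → x ≈T y
  φ-injective {x} {y} eq = same x y (subst₂ (_≡±₂_ {B}) (rotate-φ x) (rotate-φ y)
    (rotate-cong (representatives (φ x)) (representatives (φ y)) eq))
    where
    same : ∀ x y → _≡±₂_ {B} (coordinatesℤ (proj₁ x)) (coordinatesℤ (proj₁ y)) → x ≈T y
    same (mkX a b _ a<B b≤a , mkStable b<a _ a-odd b-odd) (mkX c d _ c<B d≤c , mkStable d<c _ c-odd d-odd) = λ
      { (inj₁ (p , q)) → cong₂ _,_ (odd-unique B-odd a<B c<B a-odd c-odd p) (odd-unique B-odd b<B d<B b-odd d-odd q)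
      -- A crosswise match would give a = d and b = c, so that b < a contradicts d < c.
      ; (inj₂ (p , q)) → contradiction
        (subst₂ _<_ (odd-unique B-odd b<B c<B b-odd c-odd q) (odd-unique B-odd a<B d<B a-odd d-odd p) b<a)
        (<-asym d<c)
      }
      where
      b<B = ≤-<-trans b≤a a<B
      d<B = ≤-<-trans d≤c c<B

  -- The preimage consists of the odd representatives of r + s and r - s, the larger one first. They
  -- exist because the two classes of `c` are distinct.
  φ-surjective : ∀ c → Σ[ x ∈ T ] (∀ {z} → z ≈T x → φ z ≈C c)
  φ-surjective c =
    let m , m<B , m-odd , m≈ = oddRepresentative B-odd (r ℤ.+ s) r+s≢0
        n , n<B , n-odd , n≈ = oddRepresentative B-odd (r ℤ.- s) r-s≢0
    in preimage m n m<B n<B m-odd n-odd m≈ n≈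
    where
    r = rep (fst c)
    s = rep (snd c)
    r+s≢0 : ¬ + B ℤ.∣ r ℤ.+ s
    r+s≢0 p = distinct c (inj₂ (subst (λ i → + B ℤ.∣ r ℤ.+ i) (sym (ℤ.neg-involutive s)) p))
    r-s≢0 : ¬ + B ℤ.∣ r ℤ.- s
    r-s≢0 p = distinct c (inj₁ p)
    ∣⇒≡ₘ0 : ∀ {i} → + B ℤ.∣ i → _≡ₘ_ B i 0ℤ
    ∣⇒≡ₘ0 {i} = subst (ℤ._∣_ (+ B)) (sym (ℤ.+-identityʳ i))
    preimage : ∀ m n → m < B → n < B → Odd m → Odd n → _≡±_ B (+ m) (r ℤ.+ s) → _≡±_ B (+ n) (r ℤ.- s) →
               Σ[ x ∈ T ] (∀ {z} → z ≈T x → φ z ≈C c)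
    preimage m n m<B n<B m-odd n-odd m≈ n≈ with <-cmp m n
    ... | tri< m<n _ _ = (mkX n m (odd⇒0< n-odd) n<B (<⇒≤ m<n) , mkStable m<n (odd⇒0< m-odd) n-odd m-odd) ,
                         λ { {z} refl → rotate-determines-φ z c (inj₂ (n≈ , m≈)) }
    ... | tri> _ _ n<m = (mkX m n (odd⇒0< m-odd) m<B (<⇒≤ n<m) , mkStable n<m (odd⇒0< n-odd) m-odd n-odd) ,
                         λ { {z} refl → rotate-determines-φ z c (inj₁ (m≈ , n≈)) }
    -- Equal representatives would make `r` or `s` zero modulo B.
    ... | tri≈ _ refl _ = contradiction
      (sum≈difference⇒∣ B-odd r s (≡±-trans B {r ℤ.+ s} {+ m} {r ℤ.- s} (≡±-sym B {+ m} {r ℤ.+ s} m≈) n≈))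
      λ { (inj₁ p) → proj₂ (fst c) (∣⇒≡ₘ0 p) ; (inj₂ p) → proj₂ (snd c) (∣⇒≡ₘ0 p) }

  φ-isBijection : IsBijection _≈T_ _≈C_ φ
  φ-isBijection = record
    { isInjection = record
      { isCongruent = record
        { cong           = λ {x} {y} → φ-cong {x} {y}
        ; isEquivalence₁ = Setoid.isEquivalence (𝒯 B)
        ; isEquivalence₂ = Setoid.isEquivalence (Choose₂ (P B))
        }
      ; injective   = λ {x} {y} → φ-injective {x} {y}
      }
    ; surjective  = φ-surjective
    }

  -- Since rotation commutes with doubling, the rotated claim is `stable-K-doubles`.
  φ-conjugates : ∀ x x-stable → φ (K x , K-stable B-odd x x-stable) ≈C Func.to (δ B-odd) (φ (x , x-stable))
  φ-conjugates x x-stable = rotate-determines-φ (K x , K-stable B-odd x x-stable) (Func.to (δ B-odd) (φ (x , x-stable)))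
    (subst (_≡±₂_ {B} (coordinatesℤ (K x)))
      (trans (cong (λ (i , j) → double i , double j) (sym (rotate-φ (x , x-stable))))
             (rotate-double (+ halfSum x) (+ halfDifference x)))
      (proj₂ (stable-K-doubles B-odd x x-stable)))
    where
    rotate-double : ∀ r s → (double (r ℤ.+ s) , double (r ℤ.- s)) ≡ rotate (double r , double s)
    rotate-double r s = cong₂ _,_ (sum r s) (difference r s)
      where
      sum : ∀ r s → + 2 ℤ.* (r ℤ.+ s) ≡ + 2 ℤ.* r ℤ.+ + 2 ℤ.* s
      sum = ℤ.solve-∀
      difference : ∀ r s → + 2 ℤ.* (r ℤ.- s) ≡ + 2 ℤ.* r ℤ.- + 2 ℤ.* s
      difference = ℤ.solve-∀

theorem1p1 : (B : ℕ) → 3 < B → (B-odd : Odd B) →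
    Σ[ K-stable ∈ ((x : X B) → Stable x → Stable (K x)) ]
    ((x : X B) → Stable (K (K (K x)))) ×
    (Σ[ Φ-defined ∈ ((x : X B) → Stable x → ΦDefinedAt x) ]
    IsBijection (Setoid._≈_ (𝒯 B)) (Setoid._≈_ (Choose₂ (P B))) (Φ Φ-defined) ×
    ((x : X B) (x-stable : Stable x) →
    Setoid._≈_ (Choose₂ (P B))
    (Φ Φ-defined (K x , K-stable x x-stable))
    (Func.to (δ B-odd) (Φ Φ-defined (x , x-stable)))))
theorem1p1 B 3<B B-odd =
  K-stable B-odd , K³-stable 3<B B-odd , Φ-defined B-odd , φ-isBijection B-odd , φ-conjugates B-odd
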